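{- Let $G_1,G_2$ be grammars, $p$ a pattern, $t,u$ terms, $b$ a binding set and $C$ a context. Then: (1) if $G_1\vdash t:p_{G_2}\mid b$ is derivable, then the entry $(\bullet,b)$ belongs to the list $M_{ev}\,G_1\,(t,p,G_2)$; (2) if $G_1\vdash t=C[u]:p_{G_2}\mid b$ is derivable, then there exists evidence $ev$ that either ($u=t$ and $C=\mathsf{hole}$) or $u<_{\mathsf{sub}}t$, such that the entry $((C,u)^{ev},b)$ belongs to the list $M_{ev}\,G_1\,(t,p,G_2)$.
   Context: **Terms and patterns.** Fix sets of literals $a$, pattern variables $x$ and non-terminals $n$, each with decidable equality. Terms $t,u$, list terms $l$, contexts $C$ and list contexts $L$ are mutually inductively generated by $t ::= \mathsf{lit}\,a \mid l \mid C$; $l ::= \mathsf{nil}\mid \mathsf{cons}\;t\;l$; $C ::= \mathsf{hole}\mid L$; $L ::= \mathsf{hd}\;C\;l \mid \mathsf{tl}\;t\;L$ (injections between categories are left implicit). Patterns $p$ and list patterns $q$: $p ::= \mathsf{lit}\,a\mid \mathsf{hole}\mid q\mid \mathsf{name}\,x\,p\mid \mathsf{nt}\,n\mid \mathsf{in\text{ - }hole}\,p_c\,p_h$; $q::=\mathsf{nil}\mid\mathsf{cons}\;p\;q$. A term is structured if it is $\mathsf{cons}\;t_1\;l$, with head $t_1$ and tail $l$; or $\mathsf{hd}\;C\;l$, with head $C$ and tail $l$; or $\mathsf{tl}\;t_1\;L$, with head $t_1$ and tail $L$ (heads and tails viewed as terms). Each possible tail has an underlying list term: $\lfloor l\rfloor=l$,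 $\lfloor \mathsf{hd}\;C\;l\rfloor=\mathsf{cons}\;C\;l$, $\lfloor\mathsf{tl}\;t\;L\rfloor=\mathsf{cons}\;t\;\lfloor L\rfloor$. The relation $u<_{\mathsf{sub}}t$ ($u$ is a proper sub-term of $t$) is the transitive closure of "$u$ is the head or the tail of the structured term $t$". Composition of contexts: $\mathsf{hole}\mathbin{+\!+}C'=C'$, $(\mathsf{hd}\;C\;l)\mathbin{+\!+}C'=\mathsf{hd}\;(C\mathbin{+\!+}C')\;l$, $(\mathsf{tl}\;t\;L)\mathbin{+\!+}C'=\mathsf{tl}\;t\;(L\mathbin{+\!+}C')$. **Grammars and bindings.** A production is a pair $(n,p)$. A grammar $G$ is a finite set of productions; $p\in G(n)$ means $(n,p)\in G$; $G\setminus(n,p)$ is $G$ with $(n,p)$ removed. A binding set $b$ is a finite partial function from pattern variables to terms; $\varnothing$ is the empty one. $b\sqcup b'$ is the union; it is defined only if $b$ and $b'$ agree wherever both are defined. Any rule or expression containing $\sqcup$ applies only when the union is defined. **Judgments.** Matching $G\vdash t:p_{G'}\mid b$ and decomposition $G\vdash t=C[u]:p_{G'}\mid b$ are the least relations closed under the following rules. Matching: - $G\vdash \mathsf{lit}\,a:(\mathsf{lit}\,a)_{G'}\mid\varnothing$; $G\vdash\mathsf{hole}:\mathsf{hole}_{G'}\mid\varnothing$; $G\vdash\mathsf{nil}:\mathsf{nil}_{G'}\mid\varnothing$. - If $G\vdash t:p_{G'}\mid b$ then $G\vdash t:(\mathsf{name}\,x\,p)_{G'}\mid b\sqcup\{(x,t)\}$.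 - If $p\in G'(n)$ and $G\vdash t:p_{G'\setminus(n,p)}\mid b$ then $G\vdash t:(\mathsf{nt}\,n)_{G'}\mid\varnothing$. - If $s$ is structured with head $t_1$ and tail $t_2$, $G\vdash t_1:(p_1)_G\mid b_1$ and $G\vdash t_2:(p_2)_G\mid b_2$, then $G\vdash s:(\mathsf{cons}\,p_1\,p_2)_{G'}\mid b_1\sqcup b_2$. - If $G\vdash t=C[u]:(p_c)_{G'}\mid b_c$, $u<_{\mathsf{sub}}t$ and $G\vdash u:(p_h)_G\mid b_h$, then $G\vdash t:(\mathsf{in\text{ - }hole}\,p_c\,p_h)_{G'}\mid b_c\sqcup b_h$. - If $G\vdash t=\mathsf{hole}[t]:(p_c)_{G'}\mid b_c$ and $G\vdash t:(p_h)_{G'}\mid b_h$, then $G\vdash t:(\mathsf{in\text{ - }hole}\,p_c\,p_h)_{G'}\mid b_c\sqcup b_h$. Decomposition: - $G\vdash t=\mathsf{hole}[t]:\mathsf{hole}_{G'}\mid\varnothing$. - If $s$ is structured with head $t_1$ and tail $t_2$, $G\vdash t_1=C[u]:(p_1)_G\mid b_1$ and $G\vdash t_2:(p_2)_G\mid b_2$, then $G\vdash s=(\mathsf{hd}\;C\;\lfloor t_2\rfloor)[u]:(\mathsf{cons}\,p_1\,p_2)_{G'}\mid b_1\sqcup b_2$. - If $s$ is structured with head $t_1$ and tail $t_2$, $G\vdash t_1:(p_1)_G\mid b_1$ and $G\vdash t_2=C[u]:(p_2)_G\mid b_2$ with $C$ a list context, then $G\vdash s=(\mathsf{tl}\;t_1\;C)[u]:(\mathsf{cons}\,p_1\,p_2)_{G'}\mid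 b_1\sqcup b_2$. - If $p\in G'(n)$ and $G\vdash t=C[u]:p_{G'\setminus(n,p)}\mid b$ then $G\vdash t=C[u]:(\mathsf{nt}\,n)_{G'}\mid\varnothing$. - If $G\vdash t=C_c[t_c]:(p_c)_{G'}\mid b_c$, $t_c<_{\mathsf{sub}}t$ and $G\vdash t_c=C_h[t_h]:(p_h)_G\mid b_h$, then $G\vdash t=(C_c\mathbin{+\!+}C_h)[t_h]:(\mathsf{in\text{ - }hole}\,p_c\,p_h)_{G'}\mid b_c\sqcup b_h$. - If $G\vdash t=\mathsf{hole}[t]:(p_c)_{G'}\mid b_c$ and $G\vdash t=C_h[t_h]:(p_h)_{G'}\mid b_h$, then $G\vdash t=(\mathsf{hole}\mathbin{+\!+}C_h)[t_h]:(\mathsf{in\text{ - }hole}\,p_c\,p_h)_{G'}\mid b_c\sqcup b_h$. - If $G\vdash t=C[u]:p_{G'}\mid b$ then $G\vdash t=C[u]:(\mathsf{name}\,x\,p)_{G'}\mid b\sqcup\{(x,C)\}$. **Algorithm.** $M_{ev}\,g_1\,(t,p,g_2)$ is a finite list of entries $(d,b)$, where $b$ is a binding set and $d$ is either $\bullet$ (a match) or $(C,u)^{ev}$ (a decomposition) with $ev$ evidence that ($u=t$ and $C=\mathsf{hole}$) or $u<_{\mathsf{sub}}t$. It is defined by well-founded recursion on $(t,p,g_2)$ (either $t$ gets $<_{\mathsf{sub}}$-smaller, or $t$ is unchanged and $p$ is replaced by an immediate sub-pattern with the grammar kept, or $t$ is unchanged and a production is removed from $g_2$): - $(\mathsf{hole},\mathsf{hole},g_2)$: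 $[((\mathsf{hole},\mathsf{hole}),\varnothing),(\bullet,\varnothing)]$; for $t\neq\mathsf{hole}$, $(t,\mathsf{hole},g_2)$: $[((\mathsf{hole},t),\varnothing)]$. - $(\mathsf{lit}\,a,\mathsf{lit}\,a,g_2)$ and $(\mathsf{nil},\mathsf{nil},g_2)$: $[(\bullet,\varnothing)]$. - $(s,\mathsf{cons}\,p_1\,p_2,g_2)$, $s$ structured with head $t_1$ and tail $t_2$: all $(d,b_1\sqcup b_2)$ with $(d_1,b_1)\in M_{ev}\,g_1\,(t_1,p_1,g_1)$, $(d_2,b_2)\in M_{ev}\,g_1\,(t_2,p_2,g_1)$, and $d=\bullet$ if $d_1=d_2=\bullet$; $d=(\mathsf{hd}\;C\;\lfloor t_2\rfloor,u)$ if $d_1=(C,u)$ and $d_2=\bullet$; $d=(\mathsf{tl}\;t_1\;C,u)$ if $d_1=\bullet$ and $d_2=(C,u)$; no entry if both are decompositions. - $(t,\mathsf{in\text{ - }hole}\,p_c\,p_h,g_2)$: all $(d,b_c\sqcup b_h)$ with $((C,t_c)^{ev},b_c)\in M_{ev}\,g_1\,(t,p_c,g_2)$, $(d_h,b_h)\in M_{ev}\,g_1\,(t_c,p_h,g_h)$, where $g_h=g_1$ if $ev$ shows $t_c<_{\mathsf{sub}}t$ and $g_h=g_2$ if $ev$ shows $t_c=t$; $d=\bullet$ if $d_h=\bullet$, and $d=(C\mathbin{+\!+}C_h,u)$ if $d_h=(C_h,u)$. - $(t,\mathsf{name}\,x\,p',g_2)$: all $(d,\{(x,v)\}\sqcup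 b)$ with $(d,b)\in M_{ev}\,g_1\,(t,p',g_2)$, where $v=t$ if $d=\bullet$ and $v=C$ if $d=(C,u)$. - $(t,\mathsf{nt}\,n,g_2)$: all $(d,\varnothing)$ with $p\in g_2(n)$ and $(d,b)\in M_{ev}\,g_1\,(t,p,g_2\setminus(n,p))$ for some $b$. - All other cases: the empty list. (Each produced decomposition carries the evidently corresponding evidence.) -}

module Defs where

open import Data.Bool.Base using (if_then_else_)
open import Data.List.Base
  using (List; []; _∷_; _++_; [_]; concatMap; filter; fromMaybe; length; map)
open import Data.List.Membership.Propositional using (_∈_)
open import Data.List.Properties using (filter-notAll)
open import Data.List.Relation.Unary.All as All using (All; []; _∷_)
open import Data.List.Relation.Unary.Any as Any using (here; there)
open import Data.Maybe.Base as Maybe using (Maybe; just; nothing)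
open import Data.Nat.Base using (_<_)
open import Data.Nat.Induction using (<-wellFounded)
open import Data.Product.Base using (∃; ∃₂; _×_; _,_; proj₁; map₂)
open import Data.Product.Properties using (≡-dec)
open import Data.Product.Relation.Binary.Pointwise.NonDependent using (×-setoid)
open import Data.Sum.Base using (_⊎_; inj₁; inj₂)
open import Function.Base using (_∘_; _on_)
open import Induction.WellFounded using (Acc; acc; WellFounded)
open import Level using (0ℓ)
open import Relation.Binary.Bundles using (Setoid)
open import Relation.Binary.Construct.Closure.Transitive as Plus
  using (TransClosure; _∷_) renaming ([_] to [_]⁺)
open import Relation.Binary.Construct.On as On using ()
open import Relation.Binary.Definitions using (DecidableEquality)
open import Relation.Binary.PropositionalEquality
  using (_≡_; refl; sym; trans; setoid)
open import Relation.Nullary using (Dec; yes; no; does; ¬?; contradiction; map′)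
open import Relation.Nullary.Decidable using (_×-dec_)

module Matching
  {Lit Var NT : Set}
  (_≟ˡ_ : DecidableEquality Lit)
  (_≟ᵛ_ : DecidableEquality Var)
  (_≟ⁿ_ : DecidableEquality NT)
  where

  infixr 5 _⧺_ _⧺ˡ_
  infix  4 _<sub_ _≈_

  data Term        : Set
  data ListTerm    : Set
  data Context     : Set
  data ListContext : Set

  data Term where
    lit : Lit → Term
    lst : ListTerm → Term
    ctx : Context → Term

  data ListTerm where
    nil  : ListTerm
    cons : Term → ListTerm → ListTerm

  data Context where
    hole : Context
    lctx : ListContext → Context

  data ListContext where
    hd : Context → ListTerm → ListContext
    tl : Term → ListContext → ListContext

  data Pattern     : Set
  data ListPattern : Set

  data Pattern where
    lit     : Lit → Pattern
    hole    : Pattern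
    lst     : ListPattern → Pattern
    name    : Var → Pattern → Pattern
    nt      : NT → Pattern
    in-hole : Pattern → Pattern → Pattern

  data ListPattern where
    nil  : ListPattern
    cons : Pattern → ListPattern → ListPattern

  infix 4 _≟ᵗ_ _≟ˡᵗ_ _≟ᶜ_ _≟ˡᶜ_ _≟ᵖ_ _≟ˡᵖ_

  _≟ᵗ_  : DecidableEquality Term
  _≟ˡᵗ_ : DecidableEquality ListTerm
  _≟ᶜ_  : DecidableEquality Context
  _≟ˡᶜ_ : DecidableEquality ListContext

  lit a ≟ᵗ lit a′ = map′ (λ { refl → refl }) (λ { refl → refl }) (a ≟ˡ a′)
  lit _ ≟ᵗ lst _  = no λ ()
  lit _ ≟ᵗ ctx _  = no λ ()
  lst _ ≟ᵗ lit _  = no λ ()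
  lst l ≟ᵗ lst l′ = map′ (λ { refl → refl }) (λ { refl → refl }) (l ≟ˡᵗ l′)
  lst _ ≟ᵗ ctx _  = no λ ()
  ctx _ ≟ᵗ lit _  = no λ ()
  ctx _ ≟ᵗ lst _  = no λ ()
  ctx C ≟ᵗ ctx C′ = map′ (λ { refl → refl }) (λ { refl → refl }) (C ≟ᶜ C′)

  nil      ≟ˡᵗ nil        = yes refl
  nil      ≟ˡᵗ cons _ _   = no λ ()
  cons _ _ ≟ˡᵗ nil        = no λ ()
  cons t l ≟ˡᵗ cons t′ l′ =
    map′ (λ { (refl , refl) → refl }) (λ { refl → refl , refl })
         ((t ≟ᵗ t′) ×-dec (l ≟ˡᵗ l′))

  hole   ≟ᶜ hole    = yes refl
  hole   ≟ᶜ lctx _  = no λ ()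
  lctx _ ≟ᶜ hole    = no λ ()
  lctx L ≟ᶜ lctx L′ = map′ (λ { refl → refl }) (λ { refl → refl }) (L ≟ˡᶜ L′)

  hd C l ≟ˡᶜ hd C′ l′ =
    map′ (λ { (refl , refl) → refl }) (λ { refl → refl , refl })
         ((C ≟ᶜ C′) ×-dec (l ≟ˡᵗ l′))
  hd _ _ ≟ˡᶜ tl _ _   = no λ ()
  tl _ _ ≟ˡᶜ hd _ _   = no λ ()
  tl t L ≟ˡᶜ tl t′ L′ =
    map′ (λ { (refl , refl) → refl }) (λ { refl → refl , refl })
         ((t ≟ᵗ t′) ×-dec (L ≟ˡᶜ L′))

  _≟ᵖ_  : DecidableEquality Pattern
  _≟ˡᵖ_ : DecidableEquality ListPattern

  lit a       ≟ᵖ lit a′      = map′ (λ { refl → refl }) (λ { refl → refl }) (a ≟ˡ a′)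
  lit _       ≟ᵖ hole        = no λ ()
  lit _       ≟ᵖ lst _       = no λ ()
  lit _       ≟ᵖ name _ _    = no λ ()
  lit _       ≟ᵖ nt _        = no λ ()
  lit _       ≟ᵖ in-hole _ _ = no λ ()
  hole        ≟ᵖ lit _       = no λ ()
  hole        ≟ᵖ hole        = yes refl
  hole        ≟ᵖ lst _       = no λ ()
  hole        ≟ᵖ name _ _    = no λ ()
  hole        ≟ᵖ nt _        = no λ ()
  hole        ≟ᵖ in-hole _ _ = no λ ()
  lst _       ≟ᵖ lit _       = no λ ()
  lst _       ≟ᵖ hole        = no λ ()
  lst q       ≟ᵖ lst q′      = map′ (λ { refl → refl }) (λ { refl → refl }) (q ≟ˡᵖ q′)
  lst _       ≟ᵖ name _ _    = no λ ()
  lst _       ≟ᵖ nt _        = no λ ()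
  lst _       ≟ᵖ in-hole _ _ = no λ ()
  name _ _    ≟ᵖ lit _       = no λ ()
  name _ _    ≟ᵖ hole        = no λ ()
  name _ _    ≟ᵖ lst _       = no λ ()
  name x p    ≟ᵖ name x′ p′  =
    map′ (λ { (refl , refl) → refl }) (λ { refl → refl , refl })
         ((x ≟ᵛ x′) ×-dec (p ≟ᵖ p′))
  name _ _    ≟ᵖ nt _        = no λ ()
  name _ _    ≟ᵖ in-hole _ _ = no λ ()
  nt _        ≟ᵖ lit _       = no λ ()
  nt _        ≟ᵖ hole        = no λ ()
  nt _        ≟ᵖ lst _       = no λ ()
  nt _        ≟ᵖ name _ _    = no λ ()
  nt n        ≟ᵖ nt n′       = map′ (λ { refl → refl }) (λ { refl → refl }) (n ≟ⁿ n′)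
  nt _        ≟ᵖ in-hole _ _ = no λ ()
  in-hole _ _ ≟ᵖ lit _       = no λ ()
  in-hole _ _ ≟ᵖ hole        = no λ ()
  in-hole _ _ ≟ᵖ lst _       = no λ ()
  in-hole _ _ ≟ᵖ name _ _    = no λ ()
  in-hole _ _ ≟ᵖ nt _        = no λ ()
  in-hole p r ≟ᵖ in-hole p′ r′ =
    map′ (λ { (refl , refl) → refl }) (λ { refl → refl , refl })
         ((p ≟ᵖ p′) ×-dec (r ≟ᵖ r′))

  nil      ≟ˡᵖ nil        = yes refl
  nil      ≟ˡᵖ cons _ _   = no λ ()
  cons _ _ ≟ˡᵖ nil        = no λ ()
  cons p q ≟ˡᵖ cons p′ q′ =
    map′ (λ { (refl , refl) → refl }) (λ { refl → refl , refl })
         ((p ≟ᵖ p′) ×-dec (q ≟ˡᵖ q′))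

  data Tail : Set where
    lst  : ListTerm → Tail
    lctx : ListContext → Tail

  tailTerm : Tail → Term
  tailTerm (lst l)  = lst l
  tailTerm (lctx L) = ctx (lctx L)

  ⌊_⌋ : Tail → ListTerm
  ⌊ lst l ⌋         = l
  ⌊ lctx (hd C l) ⌋ = cons (ctx C) l
  ⌊ lctx (tl t L) ⌋ = cons t ⌊ lctx L ⌋

  -- Structured s t₁ t₂: s is structured with head t₁ and tail t₂.
  data Structured : Term → Term → Tail → Set where
    cons : ∀ {t l} → Structured (lst (cons t l)) t (lst l)
    hd   : ∀ {C l} → Structured (ctx (lctx (hd C l))) (ctx C) (lst l)
    tl   : ∀ {t L} → Structured (ctx (lctx (tl t L))) t (lctx L)

  structured? : (s : Term) → Maybe (∃₂ (Structured s))
  structured? (lst (cons _ _))        = just (_ , _ , cons)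
  structured? (ctx (lctx (hd _ _)))   = just (_ , _ , hd)
  structured? (ctx (lctx (tl _ _)))   = just (_ , _ , tl)
  structured? (lit _)                 = nothing
  structured? (lst nil)               = nothing
  structured? (ctx hole)              = nothing

  data _IsPartOf_ : Term → Term → Set where
    head : ∀ {s t₁ t₂} → Structured s t₁ t₂ → t₁ IsPartOf s
    tail : ∀ {s t₁ t₂} → Structured s t₁ t₂ → tailTerm t₂ IsPartOf s

  _<sub_ : Term → Term → Set
  _<sub_ = TransClosure _IsPartOf_

  _⧺_  : Context → Context → Context
  _⧺ˡ_ : ListContext → Context → ListContext

  hole   ⧺ C′ = C′
  lctx L ⧺ C′ = lctx (L ⧺ˡ C′)

  hd C l ⧺ˡ C′ = hd (C ⧺ C′) l
  tl t L ⧺ˡ C′ = tl t (L ⧺ˡ C′)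

  Production : Set
  Production = NT × Pattern

  -- Lists stand for finite sets: the judgments use a grammar only through _∈_
  -- and _∖_, and _∖_ removes every copy of a production. Order and repetitions
  -- affect only the order and repetitions of the algorithm's output.
  Grammar : Set
  Grammar = List Production

  _∖_ : Grammar → Production → Grammar
  G ∖ π = filter (λ π′ → ¬? (≡-dec _≟ⁿ_ _≟ᵖ_ π′ π)) G

  productions : (n : NT) (G : Grammar) → List (∃ λ p → (n , p) ∈ G)
  productions n []             = []
  productions n ((n′ , p) ∷ G) with n ≟ⁿ n′
  ... | yes refl = (p , here refl) ∷ map (map₂ there) (productions n G)
  ... | no _     = map (map₂ there) (productions n G)

  -- The association list b stands for the finite partial function
  -- lookup b (the first entry of a variable counts). Two lists are the same
  -- binding set when they are related by _≈_.
  Bindings : Set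
  Bindings = List (Var × Term)

  ∅ : Bindings
  ∅ = []

  lookup : Bindings → Var → Maybe Term
  lookup []            x = nothing
  lookup ((y , t) ∷ b) x = if does (x ≟ᵛ y) then just t else lookup b x

  _≈_ : Bindings → Bindings → Set
  b ≈ b′ = ∀ x → lookup b x ≡ lookup b′ x

  bindings-setoid : Setoid 0ℓ 0ℓ
  bindings-setoid = record
    { Carrier       = Bindings
    ; _≈_           = _≈_
    ; isEquivalence = record
      { refl  = λ _ → refl
      ; sym   = λ e x → sym (e x)
      ; trans = λ e f x → trans (e x) (f x)
      }
    }

  AgreeAt : Bindings → Bindings → Var → Set
  AgreeAt b b′ x = ∀ t t′ → lookup b x ≡ just t → lookup b′ x ≡ just t′ → t ≡ t′

  Compatible : Bindings → Bindings → Set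
  Compatible b b′ = ∀ x → AgreeAt b b′ x

  agreeAt? : ∀ b b′ x → Dec (AgreeAt b b′ x)
  agreeAt? b b′ x with lookup b x | lookup b′ x
  ... | nothing | _       = yes λ _ _ ()
  ... | just _  | nothing = yes λ _ _ _ ()
  ... | just t  | just t′ = map′ (λ { refl _ _ refl refl → refl }) (λ f → f t t′ refl refl) (t ≟ᵗ t′)

  compatible? : ∀ b b′ → Dec (Compatible b b′)
  compatible? b b′ = map′ to from (All.all? (agreeAt? b b′ ∘ proj₁) b)
    where
    All-lookup : ∀ {P : Var → Set} c → All (P ∘ proj₁) c →
                 ∀ x {t} → lookup c x ≡ just t → P x
    All-lookup ((y , _) ∷ c) (py ∷ pc) x eq with x ≟ᵛ y
    ... | yes refl = py
    ... | no _     = All-lookup c pc x eq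

    to : All (AgreeAt b b′ ∘ proj₁) b → Compatible b b′
    to all x t t′ eq = All-lookup {P = AgreeAt b b′} b all x eq t t′ eq

    from : Compatible b b′ → All (AgreeAt b b′ ∘ proj₁) b
    from comp = All.universal (λ (x , _) → comp x) b

  -- nothing: the union is undefined.
  _⊔_ : Bindings → Bindings → Maybe Bindings
  b ⊔ b′ = if does (compatible? b b′) then just (b ++ b′) else nothing

  infix 3 _⊢_∶_⟨_⟩∣_ _⊢_≐_[_]∶_⟨_⟩∣_

  data _⊢_∶_⟨_⟩∣_ (G : Grammar) :
         Term → Pattern → Grammar → Bindings → Set
  data _⊢_≐_[_]∶_⟨_⟩∣_ (G : Grammar) :
         Term → Context → Term → Pattern → Grammar → Bindings → Set

  -- The rules resp make both judgments relations on binding sets rather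
  -- than on the association lists representing them.

  data _⊢_∶_⟨_⟩∣_ G where
    resp : ∀ {t p G′ b b′} → b ≈ b′ →
           G ⊢ t ∶ p ⟨ G′ ⟩∣ b →
           G ⊢ t ∶ p ⟨ G′ ⟩∣ b′

    lit  : ∀ {a G′} → G ⊢ lit a ∶ lit a ⟨ G′ ⟩∣ ∅
    hole : ∀ {G′} → G ⊢ ctx hole ∶ hole ⟨ G′ ⟩∣ ∅
    nil  : ∀ {G′} → G ⊢ lst nil ∶ lst nil ⟨ G′ ⟩∣ ∅

    name : ∀ {t x p G′ b b′} →
           G ⊢ t ∶ p ⟨ G′ ⟩∣ b →
           b ⊔ [ (x , t) ] ≡ just b′ →
           G ⊢ t ∶ name x p ⟨ G′ ⟩∣ b′

    nt   : ∀ {t n p G′ b} →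
           (n , p) ∈ G′ →
           G ⊢ t ∶ p ⟨ G′ ∖ (n , p) ⟩∣ b →
           G ⊢ t ∶ nt n ⟨ G′ ⟩∣ ∅

    cons : ∀ {s t₁ t₂ p₁ p₂ G′ b₁ b₂ b} →
           Structured s t₁ t₂ →
           G ⊢ t₁ ∶ p₁ ⟨ G ⟩∣ b₁ →
           G ⊢ tailTerm t₂ ∶ lst p₂ ⟨ G ⟩∣ b₂ →
           b₁ ⊔ b₂ ≡ just b →
           G ⊢ s ∶ lst (cons p₁ p₂) ⟨ G′ ⟩∣ b

    in-hole-sub  : ∀ {t C u p-c p-h G′ b-c b-h b} →
                   G ⊢ t ≐ C [ u ]∶ p-c ⟨ G′ ⟩∣ b-c →
                   u <sub t →
                   G ⊢ u ∶ p-h ⟨ G ⟩∣ b-h →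
                   b-c ⊔ b-h ≡ just b →
                   G ⊢ t ∶ in-hole p-c p-h ⟨ G′ ⟩∣ b

    in-hole-hole : ∀ {t p-c p-h G′ b-c b-h b} →
                   G ⊢ t ≐ hole [ t ]∶ p-c ⟨ G′ ⟩∣ b-c →
                   G ⊢ t ∶ p-h ⟨ G′ ⟩∣ b-h →
                   b-c ⊔ b-h ≡ just b →
                   G ⊢ t ∶ in-hole p-c p-h ⟨ G′ ⟩∣ b

  data _⊢_≐_[_]∶_⟨_⟩∣_ G where
    resp : ∀ {t C u p G′ b b′} → b ≈ b′ →
           G ⊢ t ≐ C [ u ]∶ p ⟨ G′ ⟩∣ b →
           G ⊢ t ≐ C [ u ]∶ p ⟨ G′ ⟩∣ b′

    hole : ∀ {t G′} → G ⊢ t ≐ hole [ t ]∶ hole ⟨ G′ ⟩∣ ∅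

    cons-hd : ∀ {s t₁ t₂ C u p₁ p₂ G′ b₁ b₂ b} →
              Structured s t₁ t₂ →
              G ⊢ t₁ ≐ C [ u ]∶ p₁ ⟨ G ⟩∣ b₁ →
              G ⊢ tailTerm t₂ ∶ lst p₂ ⟨ G ⟩∣ b₂ →
              b₁ ⊔ b₂ ≡ just b →
              G ⊢ s ≐ lctx (hd C ⌊ t₂ ⌋) [ u ]∶ lst (cons p₁ p₂) ⟨ G′ ⟩∣ b

    cons-tl : ∀ {s t₁ t₂ L u p₁ p₂ G′ b₁ b₂ b} →
              Structured s t₁ t₂ →
              G ⊢ t₁ ∶ p₁ ⟨ G ⟩∣ b₁ →
              G ⊢ tailTerm t₂ ≐ lctx L [ u ]∶ lst p₂ ⟨ G ⟩∣ b₂ →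
              b₁ ⊔ b₂ ≡ just b →
              G ⊢ s ≐ lctx (tl t₁ L) [ u ]∶ lst (cons p₁ p₂) ⟨ G′ ⟩∣ b

    nt   : ∀ {t C u n p G′ b} →
           (n , p) ∈ G′ →
           G ⊢ t ≐ C [ u ]∶ p ⟨ G′ ∖ (n , p) ⟩∣ b →
           G ⊢ t ≐ C [ u ]∶ nt n ⟨ G′ ⟩∣ ∅

    in-hole-sub  : ∀ {t C-c t-c C-h t-h p-c p-h G′ b-c b-h b} →
                   G ⊢ t ≐ C-c [ t-c ]∶ p-c ⟨ G′ ⟩∣ b-c →
                   t-c <sub t →
                   G ⊢ t-c ≐ C-h [ t-h ]∶ p-h ⟨ G ⟩∣ b-h →
                   b-c ⊔ b-h ≡ just b →
                   G ⊢ t ≐ C-c ⧺ C-h [ t-h ]∶ in-hole p-c p-h ⟨ G′ ⟩∣ b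

    in-hole-hole : ∀ {t C-h t-h p-c p-h G′ b-c b-h b} →
                   G ⊢ t ≐ hole [ t ]∶ p-c ⟨ G′ ⟩∣ b-c →
                   G ⊢ t ≐ C-h [ t-h ]∶ p-h ⟨ G′ ⟩∣ b-h →
                   b-c ⊔ b-h ≡ just b →
                   G ⊢ t ≐ hole ⧺ C-h [ t-h ]∶ in-hole p-c p-h ⟨ G′ ⟩∣ b

    name : ∀ {t C u x p G′ b b′} →
           G ⊢ t ≐ C [ u ]∶ p ⟨ G′ ⟩∣ b →
           b ⊔ [ (x , ctx C) ] ≡ just b′ →
           G ⊢ t ≐ C [ u ]∶ name x p ⟨ G′ ⟩∣ b′

  infix 4 _⊏_ _≺_

  data _⊏_ : Pattern → Pattern → Set where
    name      : ∀ {x p} → p ⊏ name x p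
    in-hole-c : ∀ {p-c p-h} → p-c ⊏ in-hole p-c p-h
    in-hole-h : ∀ {p-c p-h} → p-h ⊏ in-hole p-c p-h
    cons-hd   : ∀ {p q} → p ⊏ lst (cons p q)
    cons-tl   : ∀ {p q} → lst q ⊏ lst (cons p q)

  Config : Set
  Config = Term × Pattern × Grammar

  data _≺_ : Config → Config → Set where
    sub  : ∀ {t t′ p p′ g g′} → t′ <sub t → (t′ , p′ , g′) ≺ (t , p , g)
    pat  : ∀ {t p p′ g} → p′ ⊏ p → (t , p′ , g) ≺ (t , p , g)
    prod : ∀ {t p p′ n g} → (n , p′) ∈ g → (t , p′ , g ∖ (n , p′)) ≺ (t , p , g)

  IsPartOf-wellFounded : WellFounded _IsPartOf_
  IsPartOf-wellFounded = term
    where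
    term : ∀ t → Acc _IsPartOf_ t
    lstT : ∀ l → Acc _IsPartOf_ (lst l)
    ctxT : ∀ C → Acc _IsPartOf_ (ctx C)
    lctxT : ∀ L → Acc _IsPartOf_ (ctx (lctx L))

    term (lit _) = acc λ { (head ()) ; (tail ()) }
    term (lst l) = lstT l
    term (ctx C) = ctxT C

    lstT nil        = acc λ { (head ()) ; (tail ()) }
    lstT (cons t l) = acc λ { (head cons) → term t ; (tail cons) → lstT l }

    ctxT hole     = acc λ { (head ()) ; (tail ()) }
    ctxT (lctx L) = lctxT L

    lctxT (hd C l) = acc λ { (head hd) → ctxT C ; (tail hd) → lstT l }
    lctxT (tl t L) = acc λ { (head tl) → term t ; (tail tl) → lctxT L }

  <sub-wellFounded : WellFounded _<sub_
  <sub-wellFounded = Plus.wellFounded _ IsPartOf-wellFounded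

  ⊏-wellFounded : WellFounded _⊏_
  ⊏-wellFounded = pattern′
    where
    pattern′ : ∀ p → Acc _⊏_ p
    list     : ∀ q → Acc _⊏_ (lst q)

    pattern′ (lit _)       = acc λ ()
    pattern′ hole          = acc λ ()
    pattern′ (lst q)       = list q
    pattern′ (name _ p)    = acc λ { name → pattern′ p }
    pattern′ (nt _)        = acc λ ()
    pattern′ (in-hole p r) = acc λ { in-hole-c → pattern′ p ; in-hole-h → pattern′ r }

    list nil        = acc λ ()
    list (cons p q) = acc λ { cons-hd → pattern′ p ; cons-tl → list q }

  ∖-length : ∀ {π} g → π ∈ g → length (g ∖ π) < length g
  ∖-length {π} g π∈g =
    filter-notAll (λ π′ → ¬? (≡-dec _≟ⁿ_ _≟ᵖ_ π′ π)) g
      (Any.map (λ π≡π′ π′≢π → contradiction (sym π≡π′) π′≢π) π∈g)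

  ≺-wellFounded : WellFounded _≺_
  ≺-wellFounded (t , p , g) =
    go (<sub-wellFounded t) (On.wellFounded length <-wellFounded g) (⊏-wellFounded p)
    where
    go   : ∀ {t p g} → Acc _<sub_ t → Acc (_<_ on length) g → Acc _⊏_ p →
           Acc _≺_ (t , p , g)
    step : ∀ {t p g c} → Acc _<sub_ t → Acc (_<_ on length) g → Acc _⊏_ p →
           c ≺ (t , p , g) → Acc _≺_ c

    go at ag ap = acc (step at ag ap)

    step (acc rt) _ _ (sub {g′ = g′} u<t) =
      go (rt u<t) (On.wellFounded length <-wellFounded g′) (⊏-wellFounded _)
    step at ag (acc rp) (pat p′⊏p) = go at ag (rp p′⊏p)
    step {g = g} at (acc rg) _ (prod π∈g) =
      go at (rg (∖-length g π∈g)) (⊏-wellFounded _)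

  Evidence : Term → Context → Term → Set
  Evidence t C u = (u ≡ t × C ≡ hole) ⊎ (u <sub t)

  infix 6 ⟪_,_⟫^_

  data Result (t : Term) : Set where
    ●       : Result t
    ⟪_,_⟫^_ : (C : Context) (u : Term) → Evidence t C u → Result t

  Entry : Term → Set
  Entry t = Result t × Bindings

  entry-setoid : Term → Setoid 0ℓ 0ℓ
  entry-setoid t = ×-setoid (setoid (Result t)) bindings-setoid

  module _ {t : Term} where
    open import Data.List.Membership.Setoid (entry-setoid t) public
      using () renaming (_∈_ to _∈ᴱ_)

  inside : ∀ {s t C C′ u} → t IsPartOf s → Evidence t C u → Evidence s C′ u
  inside part (inj₁ (refl , _)) = inj₂ [ part ]⁺
  inside part (inj₂ u<t)        = inj₂ (u<t Plus.∷ʳ part)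

  compose : ∀ {t C t′ C′ u} →
            Evidence t C t′ → Evidence t′ C′ u → Evidence t (C ⧺ C′) u
  compose (inj₁ (refl , refl)) ev′                = ev′
  compose (inj₂ t′<t)          (inj₁ (refl , _))  = inj₂ t′<t
  compose (inj₂ t′<t)          (inj₂ u<t′)        = inj₂ (u<t′ Plus.++ t′<t)

  -- The clause for ⟪ hole , u ⟫ in the tail is never used: the tail is matched
  -- against a list pattern, and decompositions under list patterns have a list
  -- context.
  consResult : ∀ {s t₁ t₂} → Structured s t₁ t₂ →
               Result t₁ → Result (tailTerm t₂) → Maybe (Result s)
  consResult              st ●               ●                    = just ●
  consResult {t₂ = t₂}    st (⟪ C , u ⟫^ ev) ●                    =
    just (⟪ lctx (hd C ⌊ t₂ ⌋) , u ⟫^ inside (head st) ev)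
  consResult {t₁ = t₁}    st ●               (⟪ lctx L , u ⟫^ ev) =
    just (⟪ lctx (tl t₁ L) , u ⟫^ inside (tail st) ev)
  consResult              st ●               (⟪ hole , u ⟫^ ev)   = nothing
  consResult              st (⟪ _ , _ ⟫^ _)  (⟪ _ , _ ⟫^ _)       = nothing

  consEntries : ∀ {s t₁ t₂} → Structured s t₁ t₂ →
                List (Entry t₁) → List (Entry (tailTerm t₂)) → List (Entry s)
  consEntries st es₁ es₂ =
    concatMap (λ (d₁ , b₁) →
      concatMap (λ (d₂ , b₂) →
        fromMaybe (Maybe.zip (consResult st d₁ d₂) (b₁ ⊔ b₂))) es₂) es₁

  plugResult : ∀ {t C t′} → Evidence t C t′ → Result t′ → Result t
  plugResult         ev ●                 = ●
  plugResult {C = C} ev (⟪ C′ , u ⟫^ ev′) = ⟪ C ⧺ C′ , u ⟫^ compose ev ev′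

  plugEntries : ∀ {t C t′} → Evidence t C t′ → Bindings → List (Entry t′) → List (Entry t)
  plugEntries ev b-c =
    concatMap λ (d , b-h) → fromMaybe (Maybe.map (plugResult ev d ,_) (b-c ⊔ b-h))

  inHoleEntries : ∀ {t} → List (Entry t) →
                  List (Entry t) → (∀ {t-c} → t-c <sub t → List (Entry t-c)) →
                  List (Entry t)
  inHoleEntries {t} es-c es-whole es-part = concatMap continue es-c
    where
    continue : Entry t → List (Entry t)
    continue (● , _)                                  = []
    continue (⟪ C , _ ⟫^ ev@(inj₁ (refl , _)) , b-c)  = plugEntries {C = C} ev b-c es-whole
    continue (⟪ C , _ ⟫^ ev@(inj₂ t-c<t) , b-c)       = plugEntries {C = C} ev b-c (es-part t-c<t)

  boundValue : ∀ {t} → Result t → Term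
  boundValue {t} ●              = t
  boundValue     (⟪ C , _ ⟫^ _) = ctx C

  nameEntries : ∀ {t} → Var → List (Entry t) → List (Entry t)
  nameEntries x =
    concatMap λ (d , b) → fromMaybe (Maybe.map (d ,_) ([ (x , boundValue d) ] ⊔ b))

  ntEntries : ∀ {t} n g → (∀ {p} → (n , p) ∈ g → List (Entry t)) → List (Entry t)
  ntEntries n g entries =
    concatMap (λ (_ , np∈g) → map (λ (d , _) → d , ∅) (entries np∈g)) (productions n g)

  M-acc : Grammar → ∀ t p g → Acc _≺_ (t , p , g) → List (Entry t)
  M-acc g₁ t (in-hole p-c p-h) g₂ (acc rs) =
    inHoleEntries
      (M-acc g₁ t p-c g₂ (rs (pat in-hole-c)))
      (M-acc g₁ t p-h g₂ (rs (pat in-hole-h)))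
      (λ t-c<t → M-acc g₁ _ p-h g₁ (rs (sub t-c<t)))
  M-acc g₁ t (name x p′) g₂ (acc rs) =
    nameEntries x (M-acc g₁ t p′ g₂ (rs (pat name)))
  M-acc g₁ t (nt n) g₂ (acc rs) =
    ntEntries n g₂ (λ {p} np∈g₂ → M-acc g₁ t p (g₂ ∖ (n , p)) (rs (prod np∈g₂)))
  M-acc g₁ s (lst (cons p₁ p₂)) g₂ (acc rs) with structured? s
  ... | nothing             = []
  ... | just (t₁ , t₂ , st) =
    consEntries st
      (M-acc g₁ t₁ p₁ g₁ (rs (sub [ head st ]⁺)))
      (M-acc g₁ (tailTerm t₂) (lst p₂) g₁ (rs (sub [ tail st ]⁺)))
  M-acc g₁ (ctx hole) hole g₂ _ =
    (⟪ hole , ctx hole ⟫^ inj₁ (refl , refl) , ∅) ∷ (● , ∅) ∷ []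
  M-acc g₁ t hole g₂ _ = [ (⟪ hole , t ⟫^ inj₁ (refl , refl) , ∅) ]
  M-acc g₁ (lit a) (lit a′) g₂ _ = if does (a ≟ˡ a′) then [ (● , ∅) ] else []
  M-acc g₁ (lst nil) (lst nil) g₂ _ = [ (● , ∅) ]
  M-acc _ _ _ _ _ = []

  M-ev : Grammar → ((t , p , g) : Config) → List (Entry t)
  M-ev g₁ (t , p , g₂) = M-acc g₁ t p g₂ (≺-wellFounded (t , p , g₂))

{-# OPTIONS --safe #-}
module Submission where

-- Induction on the derivation, for every accessibility proof at once. Since <sub is
-- irreflexive, the evidence on an entry decides between the two in-hole rules just as
-- their side conditions do.

open import Defs
open import Data.Bool.Base using (if_then_else_)
open import Data.List.Base using (List; []; _∷_; _++_; [_]; concatMap; fromMaybe)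
open import Data.List.Membership.Propositional using (_∈_; lose)
open import Data.List.Relation.Unary.Any as Any using (Any; here; there)
open import Data.List.Relation.Unary.Any.Properties using (concatMap⁺; map⁺)
open import Data.Maybe.Base as Maybe using (just; nothing; _<∣>_)
open import Data.Product using (∃; Σ-syntax; _×_; _,_)
open import Data.Sum.Base using (inj₁; inj₂)
open import Induction.WellFounded using (Acc; acc; wf⇒irrefl)
open import Relation.Binary.Definitions using (DecidableEquality)
open import Relation.Binary.PropositionalEquality
  using (_≡_; refl; sym; trans; cong; cong₂; resp₂; module ≡-Reasoning)
open import Relation.Nullary using (¬_; Dec; does; yes; no; contradiction)
open import Relation.Nullary.Decidable using (dec-true)

module Completeness
  {Lit Var NT : Set}
  (_≟ˡ_ : DecidableEquality Lit)
  (_≟ᵛ_ : DecidableEquality Var)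
  (_≟ⁿ_ : DecidableEquality NT)
  where

  open Matching _≟ˡ_ _≟ᵛ_ _≟ⁿ_

  <sub-irrefl : ∀ {t} → ¬ t <sub t
  <sub-irrefl = wf⇒irrefl (resp₂ _<sub_) sym <sub-wellFounded refl

  lookup-++ : ∀ b b′ x → lookup (b ++ b′) x ≡ (lookup b x <∣> lookup b′ x)
  lookup-++ []            b′ x = refl
  lookup-++ ((y , _) ∷ b) b′ x with x ≟ᵛ y
  ... | yes _ = refl
  ... | no _  = lookup-++ b b′ x

  ++-cong : ∀ b b′ c c′ → b ≈ c → b′ ≈ c′ → (b ++ b′) ≈ (c ++ c′)
  ++-cong b b′ c c′ e e′ x = begin
    lookup (b ++ b′) x           ≡⟨ lookup-++ b b′ x ⟩
    lookup b x <∣> lookup b′ x   ≡⟨ cong₂ _<∣>_ (e x) (e′ x) ⟩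
    lookup c x <∣> lookup c′ x   ≡⟨ lookup-++ c c′ x ⟨
    lookup (c ++ c′) x           ∎
    where open ≡-Reasoning

  Compatible-sym : ∀ b b′ → Compatible b b′ → Compatible b′ b
  Compatible-sym b b′ comp x t t′ eq eq′ = sym (comp x t′ t eq′ eq)

  Compatible-cong : ∀ b b′ c c′ → b ≈ c → b′ ≈ c′ → Compatible b b′ → Compatible c c′
  Compatible-cong b b′ c c′ e e′ comp x t t′ eq eq′ =
    comp x t t′ (trans (e x) eq) (trans (e′ x) eq′)

  -- Concatenation is left-biased, so the two orders can differ only at variables bound on both
  -- sides; there compatibility forces equal values.
  ++-comm : ∀ b b′ → Compatible b b′ → (b ++ b′) ≈ (b′ ++ b)
  ++-comm b b′ comp x
    -- Abstracting `comp x` together with both lookups specialises its type to the values found.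
    rewrite lookup-++ b b′ x | lookup-++ b′ b x
    with lookup b x | lookup b′ x | comp x
  ... | nothing | nothing | _ = refl
  ... | nothing | just _  | _ = refl
  ... | just _  | nothing | _ = refl
  ... | just t  | just t′ | f = cong just (f t t′ refl refl)

  ⊔-defined : ∀ b b′ → Compatible b b′ → b ⊔ b′ ≡ just (b ++ b′)
  ⊔-defined b b′ comp =
    cong (if_then just (b ++ b′) else nothing) (dec-true (compatible? b b′) comp)

  ⊔-inv : ∀ b b′ {d} → b ⊔ b′ ≡ just d → Compatible b b′ × b ++ b′ ≡ d
  ⊔-inv b b′ = just-if-inv (compatible? b b′)
    where
    -- An arbitrary decision can be matched on directly; its `no` case is absurd, since it yields
    -- `nothing`.
    just-if-inv : ∀ {P : Set} {c d : Bindings} (P? : Dec P) →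
                  (if does P? then just c else nothing) ≡ just d → P × c ≡ d
    just-if-inv (yes p) refl = p , refl

  -- Transfers a union formed in a derivation to the representatives stored in the algorithm's
  -- lists, which agree with the derived bindings only up to `≈`.
  ⊔-cong : ∀ b b′ c c′ {d} → b ≈ c → b′ ≈ c′ → b ⊔ b′ ≡ just d →
           ∃ λ d′ → c ⊔ c′ ≡ just d′ × d ≈ d′
  ⊔-cong b b′ c c′ e e′ eq with ⊔-inv b b′ eq
  ... | comp , refl =
    c ++ c′ , ⊔-defined c c′ (Compatible-cong b b′ c c′ e e′ comp) ,
    ++-cong b b′ c c′ e e′

  ⊔-comm : ∀ b b′ {d} → b ⊔ b′ ≡ just d → ∃ λ d′ → b′ ⊔ b ≡ just d′ × d ≈ d′
  ⊔-comm b b′ eq with ⊔-inv b b′ eq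
  ... | comp , refl = b′ ++ b , ⊔-defined b′ b (Compatible-sym b b′ comp) , ++-comm b b′ comp

  -- Membership up to _≈_ in a form from which Agda can infer b: Agda unfolds _∈ᴱ_
  -- to pointwise equations between lookups, which do not determine it.
  record Found {t : Term} (d : Result t) (b : Bindings) (es : List (Entry t)) : Set where
    constructor found
    field
      representative : Bindings
      b≈             : b ≈ representative
      member         : (d , representative) ∈ es

  Found⇒∈ᴱ : ∀ {t} {d : Result t} {b es} → Found d b es → (d , b) ∈ᴱ es
  Found⇒∈ᴱ (found _ b≈ m) = Any.map (λ { refl → refl , b≈ }) m

  Found-resp : ∀ {t} {d : Result t} {b b′ es} → b ≈ b′ → Found d b es → Found d b′ es
  Found-resp e (found c b≈ m) = found c (λ x → trans (sym (e x)) (b≈ x)) m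

  ∈-concatMap : ∀ {A B : Set} {f : A → List B} {x y xs} → x ∈ xs → y ∈ f x → y ∈ concatMap f xs
  ∈-concatMap {f = f} x∈xs y∈fx = concatMap⁺ f (lose x∈xs y∈fx)

  ∈-fromMaybe : ∀ {A : Set} {x : A} {m} → m ≡ just x → x ∈ fromMaybe m
  ∈-fromMaybe refl = here refl

  -- Only patterns are compared; the membership proof stored beside `p′` is left open. This is why
  -- `Found-ntEntries` asks for its hypothesis at every membership proof.
  ∈-productions : ∀ n {p} g → (n , p) ∈ g → Any (λ (p′ , _) → p ≡ p′) (productions n g)
  ∈-productions n ((n′ , _) ∷ g) n∈g with n ≟ⁿ n′ | n∈g
  ... | yes refl | here refl  = here refl
  ... | yes refl | there n∈g′ = there (map⁺ (∈-productions n g n∈g′))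
  ... | no n≢n   | here refl  = contradiction refl n≢n
  ... | no _     | there n∈g′ = map⁺ (∈-productions n g n∈g′)

  Found-consEntries : ∀ {s t₁ t₂ d₁ d₂ d b₁ b₂ b es₁ es₂} (st : Structured s t₁ t₂) →
                      Found d₁ b₁ es₁ → Found d₂ b₂ es₂ →
                      consResult st d₁ d₂ ≡ just d → b₁ ⊔ b₂ ≡ just b →
                      Found d b (consEntries st es₁ es₂)
  Found-consEntries {b₁ = b₁} {b₂} st (found c₁ e₁ m₁) (found c₂ e₂ m₂) d≡ b≡ =
    let (c , c≡ , b≈c) = ⊔-cong b₁ b₂ c₁ c₂ e₁ e₂ b≡
    in found c b≈c
         (∈-concatMap m₁ (∈-concatMap m₂ (∈-fromMaybe (cong₂ Maybe.zip d≡ c≡))))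

  -- With the evidence fixed as `inj₂ u<t`, `inHoleEntries` computes: it continues with `es-part` at
  -- that same proof `u<t`.
  Found-inHoleEntries-sub :
    ∀ {t C u} {d : Result u} {b-c b-h b es-c es-whole}
      {es-part : ∀ {t-c} → t-c <sub t → List (Entry t-c)} {u<t : u <sub t} →
    Found (⟪ C , u ⟫^ inj₂ u<t) b-c es-c → Found d b-h (es-part u<t) →
    b-c ⊔ b-h ≡ just b →
    Found (plugResult {C = C} (inj₂ u<t) d) b (inHoleEntries es-c es-whole es-part)
  Found-inHoleEntries-sub {b-c = b-c} {b-h} (found c e m-c) (found c′ e′ m-h) b≡ =
    let (c″ , c≡ , b≈c) = ⊔-cong b-c b-h c c′ e e′ b≡
    in found c″ b≈c (∈-concatMap m-c (∈-concatMap m-h (∈-fromMaybe (cong (Maybe.map _) c≡))))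

  Found-inHoleEntries-hole :
    ∀ {t} {d : Result t} {b-c b-h b es-c es-whole}
      {es-part : ∀ {t-c} → t-c <sub t → List (Entry t-c)} →
    Found (⟪ hole , t ⟫^ inj₁ (refl , refl)) b-c es-c → Found d b-h es-whole →
    b-c ⊔ b-h ≡ just b →
    Found (plugResult {C = hole} (inj₁ (refl , refl)) d) b (inHoleEntries es-c es-whole es-part)
  Found-inHoleEntries-hole {b-c = b-c} {b-h} (found c e m-c) (found c′ e′ m-h) b≡ =
    let (c″ , c≡ , b≈c) = ⊔-cong b-c b-h c c′ e e′ b≡
    in found c″ b≈c (∈-concatMap m-c (∈-concatMap m-h (∈-fromMaybe (cong (Maybe.map _) c≡))))

  -- The name rule forms b ⊔ {(x , v)}, the algorithm {(x , v)} ⊔ b.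
  Found-nameEntries : ∀ {t x} {d : Result t} {b b′ es} → Found d b es →
                      b ⊔ [ (x , boundValue d) ] ≡ just b′ →
                      Found d b′ (nameEntries x es)
  Found-nameEntries {x = x} {d} {b} (found c e m) b≡ =
    let x↦d              = [ (x , boundValue d) ]
        (_ , eq , b≈)    = ⊔-comm b x↦d b≡
        (c′ , c≡ , b≈c′) = ⊔-cong x↦d b x↦d c (λ _ → refl) e eq
    in found c′ (λ y → trans (b≈ y) (b≈c′ y))
         (∈-concatMap m (∈-fromMaybe (cong (Maybe.map _) c≡)))

  Found-ntEntries :
    ∀ {t n p g} {d : Result t} {b} {entries : ∀ {p} → (n , p) ∈ g → List (Entry t)} →
    (n , p) ∈ g → (∀ np∈g → Found d b (entries {p} np∈g)) →
    Found d ∅ (ntEntries n g entries)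
  Found-ntEntries {n = n} {g = g} np∈g m =
    -- Rule and algorithm both discard the inner bindings, so the representative is `∅` itself
    -- whatever `b` is.
    found ∅ (λ _ → refl) (concatMap⁺ _ (Any.map
      (λ { {_ , np∈g′} refl → map⁺ (Any.map (cong λ (d , _) → d , ∅) (Found.member (m np∈g′))) })
      (∈-productions n g np∈g)))

  -- Rewriting with this equation resolves the `with` on `structured? s` in the `cons` clause of
  -- `M-acc`.
  structured?-complete : ∀ {s t₁ t₂} (st : Structured s t₁ t₂) →
                         structured? s ≡ just (t₁ , t₂ , st)
  structured?-complete cons = refl
  structured?-complete hd   = refl
  structured?-complete tl   = refl

  -- Serves the matching rule and both decomposition rules for `cons`; the equation on `consResult`
  -- tells them apart.
  M-acc-cons :
    ∀ {G s t₁ t₂ p₁ p₂ G′ d₁ d₂ d b₁ b₂ b} (st : Structured s t₁ t₂) →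
    (∀ a → Found d₁ b₁ (M-acc G t₁ p₁ G a)) →
    (∀ a → Found d₂ b₂ (M-acc G (tailTerm t₂) (lst p₂) G a)) →
    consResult st d₁ d₂ ≡ just d → b₁ ⊔ b₂ ≡ just b →
    ∀ a → Found d b (M-acc G s (lst (cons p₁ p₂)) G′ a)
  M-acc-cons st m₁ m₂ d≡ b≡ (acc rs) rewrite structured?-complete st =
    Found-consEntries st (m₁ _) (m₂ _) d≡ b≡

  -- `M-acc` has a separate clause for `ctx hole`, so it reduces only once the shape of `t` is
  -- known.
  M-acc-hole : ∀ {G G′} t a → Found (⟪ hole , t ⟫^ inj₁ (refl , refl)) ∅ (M-acc G t hole G′ a)
  M-acc-hole (lit _)        a = found ∅ (λ _ → refl) (here refl)
  M-acc-hole (lst _)        a = found ∅ (λ _ → refl) (here refl)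
  M-acc-hole (ctx hole)     a = found ∅ (λ _ → refl) (here refl)
  M-acc-hole (ctx (lctx _)) a = found ∅ (λ _ → refl) (here refl)

  match-complete : ∀ {G t p G′ b} → G ⊢ t ∶ p ⟨ G′ ⟩∣ b →
                   ∀ a → Found ● b (M-acc G t p G′ a)

  -- The evidence is chosen before the accessibility proof: it is part of the entry, and
  -- `M-acc-cons` needs one entry that works for all such proofs.
  decompose-complete : ∀ {G t C u p G′ b} → G ⊢ t ≐ C [ u ]∶ p ⟨ G′ ⟩∣ b →
                       Σ[ ev ∈ Evidence t C u ]
                         (∀ a → Found (⟪ C , u ⟫^ ev) b (M-acc G t p G′ a))

  match-complete (resp e D) a = Found-resp e (match-complete D a)
  match-complete (lit {a}) _ with a ≟ˡ a
  ... | yes _   = found ∅ (λ _ → refl) (here refl)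
  ... | no a≢a  = contradiction refl a≢a
  match-complete hole _ = found ∅ (λ _ → refl) (there (here refl))
  match-complete nil _ = found ∅ (λ _ → refl) (here refl)
  match-complete (name D b≡) (acc _) = Found-nameEntries (match-complete D _) b≡
  match-complete (nt np∈G′ D) (acc _) = Found-ntEntries np∈G′ (λ _ → match-complete D _)
  match-complete (cons st D₁ D₂ b≡) =
    M-acc-cons st (match-complete D₁) (match-complete D₂) refl b≡
  match-complete (in-hole-sub D-c u<t D-h b≡) (acc _) with decompose-complete D-c
  ... | inj₁ (refl , _) , _ = contradiction u<t <sub-irrefl
  -- The algorithm recurses along the proof `u<t′` found in its own entry, not along the `u<t` of
  -- the rule; the induction hypothesis for `D-h` holds at either accessibility proof.
  ... | inj₂ u<t′ , m       = Found-inHoleEntries-sub (m _) (match-complete D-h _) b≡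
  match-complete (in-hole-hole D-c D-h b≡) (acc _) with decompose-complete D-c
  ... | inj₁ (refl , refl) , m = Found-inHoleEntries-hole (m _) (match-complete D-h _) b≡
  ... | inj₂ t<t , _           = contradiction t<t <sub-irrefl

  decompose-complete (resp e D) with decompose-complete D
  ... | ev , m = ev , λ a → Found-resp e (m a)
  decompose-complete hole = inj₁ (refl , refl) , M-acc-hole _
  decompose-complete (cons-hd st D₁ D₂ b≡) with decompose-complete D₁
  -- Here `refl` evaluates `consResult`, which determines the omitted evidence as
  -- `inside (head st) ev`.
  ... | ev , m = _ , M-acc-cons st m (match-complete D₂) refl b≡
  decompose-complete (cons-tl st D₁ D₂ b≡) with decompose-complete D₂
  ... | ev , m = _ , M-acc-cons st (match-complete D₁) m refl b≡
  decompose-complete (nt np∈G′ D) with decompose-complete D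
  ... | ev , m = ev , λ { (acc _) → Found-ntEntries np∈G′ (λ _ → m _) }
  decompose-complete (in-hole-sub D-c t-c<t D-h b≡)
    with decompose-complete D-c | decompose-complete D-h
  ... | inj₁ (refl , _) , _ | _ = contradiction t-c<t <sub-irrefl
  ... | inj₂ t-c<t′ , m-c | ev , m-h =
    _ , λ { (acc _) → Found-inHoleEntries-sub (m-c _) (m-h _) b≡ }
  decompose-complete (in-hole-hole D-c D-h b≡)
    with decompose-complete D-c | decompose-complete D-h
  ... | inj₁ (refl , refl) , m-c | ev , m-h =
    -- `hole ⧺ C-h` reduces to `C-h`, and `compose` with reflexive first evidence returns the
    -- second, so `ev` is the evidence of the plugged result.
    ev , λ { (acc _) → Found-inHoleEntries-hole (m-c _) (m-h _) b≡ }
  ... | inj₂ t<t , _ | _ = contradiction t<t <sub-irrefl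
  decompose-complete (name D b≡) with decompose-complete D
  ... | ev , m = ev , λ { (acc _) → Found-nameEntries (m _) b≡ }

theorem1 : {Lit Var NT : Set}
    (_≟ˡ_ : DecidableEquality Lit) (_≟ᵛ_ : DecidableEquality Var) (_≟ⁿ_ : DecidableEquality NT) →
    let open Matching _≟ˡ_ _≟ᵛ_ _≟ⁿ_ in
    (G₁ G₂ : Grammar) (p : Pattern) (t u : Term) (b : Bindings) (C : Context) →
    (G₁ ⊢ t ∶ p ⟨ G₂ ⟩∣ b → (● , b) ∈ᴱ M-ev G₁ (t , p , G₂))
    ×
    (G₁ ⊢ t ≐ C [ u ]∶ p ⟨ G₂ ⟩∣ b →
    Σ[ ev ∈ Evidence t C u ] (⟪ C , u ⟫^ ev , b) ∈ᴱ M-ev G₁ (t , p , G₂))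
theorem1 _≟ˡ_ _≟ᵛ_ _≟ⁿ_ G₁ G₂ p t u b C =
  (λ D → Found⇒∈ᴱ (match-complete D _)) ,
  λ D → let (ev , m) = decompose-complete D in ev , Found⇒∈ᴱ (m _)
  where open Completeness _≟ˡ_ _≟ᵛ_ _≟ⁿ_
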